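{- Let $A$ be a formula of $\mathbf{L_1}$. If some normal tableau for $A$ is closed, then no normal tableau for $A$ has a branch ending with a Hintikka formula; in particular every completed normal tableau for $A$ is closed.
   Context: Formulas of $\mathbf{L_1}$: built from atomic formulas $\epsilon ab$ ($a,b$ name variables, possibly equal) with connectives $\vee,\sim$. Disjunctions may be associated in any way. Positive/negative parts (occurrences): $A$ is a positive part of $A$; if $B\vee C$ is a positive part then $B,C$ are positive parts; if $\sim B$ is a positive part then $B$ is a negative part; if $\sim B$ is a negative part then $B$ is a positive part. $F[B_+]$ ($G[B_-]$) denotes a formula with a specified occurrence of $B$ as positive (negative) part; $F[B_+,C_-]$ etc. denote specified non-overlapping occurrences. Tableaux: reduction rules ($\vee_-$) $G[B\vee C_-]$ $\mapsto$ two branches $G[B\vee C_-]\vee\sim B$, $G[B\vee C_-]\vee\sim C$; ($\epsilon_1$) $G[\epsilon ab_-]\mapsto G[\epsilon ab_-]\vee\sim\epsilon aa$; ($\epsilon_2$) $G[\epsilon ab_-,\epsilon bc_-]\mapsto G[\epsilon ab_-,\epsilon bc_-]\vee\sim\epsilon ac$; ($\epsilon_{3b}$) $G[\epsilon ab_-,\epsilon bb_-]\mapsto G[\epsilon ab_-,\epsilon bb_-]\vee\sim\epsilon ba$. A tableau for $A$ is a finite tree with root $A$ whose non-leaf nodes have as children the result of applying one rule. A branch is closed if its last formula has the form $F[B_+,B_-]$; a tableau is closed if all branches are. A tableau is normal if each rule application is made only to a formula not of the form $F[B_+,B_-]$ and only when the formula appended after $\sim$ (i.e. $B$, $C$, $\epsilon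 aa$, $\epsilon ac$ or $\epsilon ba$ respectively) does not already occur as a negative part of the formula being reduced. A normal tableau is completed if no further normal rule application is possible at the end of any branch. Hintikka formula: a formula $H$ such that (1) $H$ is not of the form $F[B_+,B_-]$; (2) if $B\vee C$ is a negative part of $H$ then $B$ or $C$ is; (3) if $\epsilon ab$ is a negative part then so is $\epsilon aa$; (4) if $\epsilon ab,\epsilon bc$ are negative parts then so is $\epsilon ac$; (5) if $\epsilon ab,\epsilon bb$ are negative parts then so is $\epsilon ba$. -}

module Defs where

open import Data.Nat using (ℕ)
open import Data.Product using (_×_; ∃; ∃₂; Σ-syntax)
open import Data.Sign using (Sign; +; -)
open import Data.Sum using (_⊎_)
open import Relation.Nullary using (¬_)

infixl 6 _∨_
infix  8 ~_

Name : Set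
Name = ℕ

-- Disjunction is a binary connective with arbitrary bracketing; formulas
-- are not identified up to associativity.
data Formula : Set where
  ε   : Name → Name → Formula
  _∨_ : Formula → Formula → Formula
  ~_  : Formula → Formula

-- An element of `Part A s B` is one occurrence of B in A as a positive
-- (s = +) or negative (s = -) part.  Negative disjunctions are not decomposed.
data Part (A : Formula) : Sign → Formula → Set where
  whole : Part A + A
  left  : ∀ {B C} → Part A + (B ∨ C) → Part A + B
  right : ∀ {B C} → Part A + (B ∨ C) → Part A + C
  neg⁺  : ∀ {B} → Part A + (~ B) → Part A - B
  neg⁻  : ∀ {B} → Part A - (~ B) → Part A + B

-- p ⊑ q : the occurrence p lies inside (or is) the occurrence q.
data _⊑_ {A : Formula} : ∀ {s t B C} → Part A s B → Part A t C → Set where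
  here  : ∀ {s B} {p : Part A s B} → p ⊑ p
  left  : ∀ {t B C D} {p : Part A + (B ∨ C)} {q : Part A t D} → p ⊑ q → left p ⊑ q
  right : ∀ {t B C D} {p : Part A + (B ∨ C)} {q : Part A t D} → p ⊑ q → right p ⊑ q
  neg⁺  : ∀ {t B D} {p : Part A + (~ B)} {q : Part A t D} → p ⊑ q → neg⁺ p ⊑ q
  neg⁻  : ∀ {t B D} {p : Part A - (~ B)} {q : Part A t D} → p ⊑ q → neg⁻ p ⊑ q

NonOverlapping : ∀ {A s t B C} → Part A s B → Part A t C → Set
NonOverlapping p q = ¬ (p ⊑ q) × ¬ (q ⊑ p)

-- A is of the form F[B₊,B₋].
Clash : Formula → Set
Clash A = ∃ λ B → Σ[ p ∈ Part A + B ] Σ[ q ∈ Part A - B ] NonOverlapping p q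

-- A ⟶ X : a non-branching rule reduces A to A ∨ ~ X.
data _⟶_ (A : Formula) : Formula → Set where
  ε₁  : ∀ {a b} → Part A - (ε a b) → A ⟶ ε a a
  ε₂  : ∀ {a b c} (p : Part A - (ε a b)) (q : Part A - (ε b c)) →
        NonOverlapping p q → A ⟶ ε a c
  ε₃b : ∀ {a b} (p : Part A - (ε a b)) (q : Part A - (ε b b)) →
        NonOverlapping p q → A ⟶ ε b a

-- A ⟶ X ∣ Y : the branching rule reduces A to A ∨ ~ X and A ∨ ~ Y.
data _⟶_∣_ (A : Formula) : Formula → Formula → Set where
  ∨₋ : ∀ {B C} → Part A - (B ∨ C) → A ⟶ B ∣ C

data Tableau (A : Formula) : Set where
  leaf : Tableau A
  one  : ∀ {X} → A ⟶ X → Tableau (A ∨ ~ X) → Tableau A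
  two  : ∀ {X Y} → A ⟶ X ∣ Y → Tableau (A ∨ ~ X) → Tableau (A ∨ ~ Y) → Tableau A

data Branch : ∀ {A} → Tableau A → Set where
  end  : ∀ {A} → Branch (leaf {A})
  one  : ∀ {A X} {r : A ⟶ X} {T} → Branch T → Branch (one r T)
  two₁ : ∀ {A X Y} {r : A ⟶ X ∣ Y} {T U} → Branch T → Branch (two r T U)
  two₂ : ∀ {A X Y} {r : A ⟶ X ∣ Y} {T U} → Branch U → Branch (two r T U)

lastFormula : ∀ {A} {T : Tableau A} → Branch T → Formula
lastFormula (end {A}) = A
lastFormula (one β)   = lastFormula β
lastFormula (two₁ β)  = lastFormula β
lastFormula (two₂ β)  = lastFormula β

Closed : ∀ {A} → Tableau A → Set
Closed T = (β : Branch T) → Clash (lastFormula β)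

-- Normality of a single application to A appending ~ X (resp. ~ X, ~ Y).
-- For the branching rule neither X nor Y may already be a negative part.
NormalOne : Formula → Formula → Set
NormalOne A X = ¬ Clash A × ¬ Part A - X

NormalTwo : Formula → Formula → Formula → Set
NormalTwo A X Y = ¬ Clash A × ¬ Part A - X × ¬ Part A - Y

data Normal : ∀ {A} → Tableau A → Set where
  leaf : ∀ {A} → Normal (leaf {A})
  one  : ∀ {A X} {r : A ⟶ X} {T} → NormalOne A X → Normal T → Normal (one r T)
  two  : ∀ {A X Y} {r : A ⟶ X ∣ Y} {T U} →
         NormalTwo A X Y → Normal T → Normal U → Normal (two r T U)

Reducible : Formula → Set
Reducible A = (∃ λ X → A ⟶ X × NormalOne A X)
            ⊎ (∃₂ λ X Y → A ⟶ X ∣ Y × NormalTwo A X Y)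

Completed : ∀ {A} → Tableau A → Set
Completed T = Normal T × ((β : Branch T) → ¬ Reducible (lastFormula β))

record Hintikka (H : Formula) : Set where
  field
    noClash : ¬ Clash H
    disj    : ∀ {B C} → Part H - (B ∨ C) → Part H - B ⊎ Part H - C
    refl-ε  : ∀ {a b} → Part H - (ε a b) → Part H - (ε a a)
    trans-ε : ∀ {a b c} → Part H - (ε a b) → Part H - (ε b c) → Part H - (ε a c)
    sym-ε   : ∀ {a b} → Part H - (ε a b) → Part H - (ε b b) → Part H - (ε b a)

{-# OPTIONS --safe #-}

-- Let H be a Hintikka formula ending a branch of some tableau for A, so that A
-- is a positive part of H.  Follow H through a closed tableau for A, always
-- into a child whose appended ~ X has X as a negative part of H; conditions
-- (2)-(5) provide one.  All along the way the negative parts of the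
-- current formula are negative parts of H, and its positive parts are not, so
-- the leaf reached cannot clash.  For the second claim, being a part and
-- clashing are decidable, so a clash-free end of a completed branch satisfies
-- the Hintikka conditions: a failing one would give a normal rule application.
module Submission where

open import Data.List using (List; []; _∷_; _++_)
open import Data.List.Membership.Propositional using (_∈_; find; lose)
open import Data.List.Membership.Propositional.Properties using (∈-++⁺ˡ; ∈-++⁺ʳ; ∈-++⁻)
open import Data.List.Relation.Unary.Any using (Any; here; there; any?)
open import Data.Nat using (ℕ; suc; _<_; s≤s) renaming (_+_ to _+ℕ_)
open import Data.Nat.Properties using (m≤m+n; m≤n+m; n<1+n; <-trans; <-irrefl)
import Data.Nat.Properties as ℕ
open import Data.Product using (_×_; Σ-syntax; _,_)
open import Data.Product.Properties using (≡-dec)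
open import Data.Sign using (Sign; +; -)
import Data.Sign.Properties as Sign
open import Data.Sum using (_⊎_; inj₁; inj₂)
open import Function using (_∘_)
open import Relation.Binary.Definitions using (DecidableEquality)
open import Relation.Binary.PropositionalEquality using (_≡_; refl; sym; cong)
open import Relation.Nullary using (¬_; Dec; yes; no; contradiction)
open import Relation.Nullary.Decidable using (map′; _×-dec_; decidable-stable)
open import Defs

size : Formula → ℕ
size (ε a b) = 0
size (B ∨ C) = suc (size B +ℕ size C)
size (~ B)   = suc (size B)

private
  descend : ∀ {s t : Sign} {B B′ C} → size B < size B′ →
    (s ≡ t × B′ ≡ C) ⊎ size B′ < size C → size B < size C
  descend B<B′ (inj₁ (_ , refl)) = B<B′
  descend B<B′ (inj₂ B′<C)       = <-trans B<B′ B′<C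

-- Every constructor of `⊑` except `here` passes to an immediate subformula and so lowers `size`.
-- Overlap can thus be refuted from signs and formulas, without comparing paths.
⊑⇒same⊎smaller : ∀ {A s t B C} {p : Part A s B} {q : Part A t C} →
  p ⊑ q → (s ≡ t × B ≡ C) ⊎ size B < size C
⊑⇒same⊎smaller here = inj₁ (refl , refl)
⊑⇒same⊎smaller (left {B = B} {C} p⊑q) =
  inj₂ (descend (s≤s (m≤m+n (size B) (size C))) (⊑⇒same⊎smaller p⊑q))
⊑⇒same⊎smaller (right {B = B} {C} p⊑q) =
  inj₂ (descend (s≤s (m≤n+m (size C) (size B))) (⊑⇒same⊎smaller p⊑q))
⊑⇒same⊎smaller (neg⁺ {B = B} p⊑q) = inj₂ (descend (n<1+n (size B)) (⊑⇒same⊎smaller p⊑q))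
⊑⇒same⊎smaller (neg⁻ {B = B} p⊑q) = inj₂ (descend (n<1+n (size B)) (⊑⇒same⊎smaller p⊑q))

-- Distinct occurrences of one formula never overlap, so the side condition of
-- a clash is automatic.
clash : ∀ {A B} → Part A + B → Part A - B → Clash A
clash p q = _ , p , q , disjoint (λ ()) , disjoint (λ ())
  where
  disjoint : ∀ {A s t B} {p : Part A s B} {q : Part A t B} → ¬ s ≡ t → ¬ (p ⊑ q)
  disjoint s≢t p⊑q with ⊑⇒same⊎smaller p⊑q
  ... | inj₁ (s≡t , _) = s≢t s≡t
  ... | inj₂ B<B       = <-irrefl refl B<B

⊑-atom : ∀ {A s t B a b} {p : Part A s B} {q : Part A t (ε a b)} → p ⊑ q → B ≡ ε a b
⊑-atom p⊑q with ⊑⇒same⊎smaller p⊑q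
-- The other case is absurd: an atom has `size` 0.
... | inj₁ (_ , B≡ε) = B≡ε

atoms-nonOverlapping : ∀ {A s t a b c d} {p : Part A s (ε a b)} {q : Part A t (ε c d)} →
  ¬ ε a b ≡ ε c d → NonOverlapping p q
atoms-nonOverlapping ≢ = ≢ ∘ ⊑-atom , ≢ ∘ sym ∘ ⊑-atom

part-trans : ∀ {H A s B} → Part H + A → Part A s B → Part H s B
part-trans h whole     = h
part-trans h (left p)  = left (part-trans h p)
part-trans h (right p) = right (part-trans h p)
part-trans h (neg⁺ p)  = neg⁺ (part-trans h p)
part-trans h (neg⁻ p)  = neg⁻ (part-trans h p)

-- Each rule keeps the reduced formula as the left disjunct of the new one.
root-part : ∀ {A} {T : Tableau A} (β : Branch T) → Part (lastFormula β) + A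
root-part end      = whole
root-part (one β)  = part-trans (root-part β) (left whole)
root-part (two₁ β) = part-trans (root-part β) (left whole)
root-part (two₂ β) = part-trans (root-part β) (left whole)

infix 4 _≟_

_≟_ : DecidableEquality Formula
ε a b ≟ ε c d   = map′ (λ { (refl , refl) → refl }) (λ { refl → refl , refl }) (a ℕ.≟ c ×-dec b ℕ.≟ d)
ε _ _ ≟ _ ∨ _   = no λ ()
ε _ _ ≟ ~ _     = no λ ()
_ ∨ _ ≟ ε _ _   = no λ ()
A ∨ B ≟ C ∨ D   = map′ (λ { (refl , refl) → refl }) (λ { refl → refl , refl }) (A ≟ C ×-dec B ≟ D)
_ ∨ _ ≟ ~ _     = no λ ()
~ _   ≟ ε _ _   = no λ ()
~ _   ≟ _ ∨ _   = no λ ()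
~ A   ≟ ~ B     = map′ (cong ~_) (λ { refl → refl }) (A ≟ B)

mutual
  -- A `Part` has its last step outermost, which does not suit a search by recursion on the formula;
  -- these lists enumerate the signed parts by such a recursion.
  parts : Sign → Formula → List (Sign × Formula)
  parts s A = (s , A) ∷ properParts s A

  properParts : Sign → Formula → List (Sign × Formula)
  properParts s (ε a b) = []
  properParts + (B ∨ C) = parts + B ++ parts + C
  properParts - (B ∨ C) = []
  properParts + (~ B)   = parts - B
  properParts - (~ B)   = parts + B

-- The occurrence `p` accumulates the path as the recursion descends.
parts-sound : ∀ {H s A t B} → Part H s A → (t , B) ∈ parts s A → Part H t B
parts-sound p (here refl) = p
parts-sound {s = +} {B ∨ C} p (there m) with ∈-++⁻ (parts + B) m
... | inj₁ m′ = parts-sound (left p) m′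
... | inj₂ m′ = parts-sound (right p) m′
parts-sound {s = +} {~ B} p (there m) = parts-sound (neg⁺ p) m
parts-sound {s = - } {~ B} p (there m) = parts-sound (neg⁻ p) m

-- Lets `parts-complete` append the last step of a path whose end is already listed.
parts-trans : ∀ s A {t B x} → (t , B) ∈ parts s A → x ∈ parts t B → x ∈ parts s A
parts-trans s A (here refl) n = n
parts-trans + (B ∨ C) (there m) n with ∈-++⁻ (parts + B) m
... | inj₁ m′ = there (∈-++⁺ˡ (parts-trans + B m′ n))
... | inj₂ m′ = there (∈-++⁺ʳ (parts + B) (parts-trans + C m′ n))
parts-trans + (~ B) (there m) n = there (parts-trans - B m n)
parts-trans - (~ B) (there m) n = there (parts-trans + B m n)

parts-complete : ∀ {A s B} → Part A s B → (s , B) ∈ parts + A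
parts-complete whole = here refl
parts-complete {A} (left p) =
  parts-trans + A (parts-complete p) (there (here refl))
parts-complete {A} (right {B = B} p) =
  parts-trans + A (parts-complete p) (there (∈-++⁺ʳ (parts + B) (here refl)))
parts-complete {A} (neg⁺ p) =
  parts-trans + A (parts-complete p) (there (here refl))
parts-complete {A} (neg⁻ p) =
  parts-trans + A (parts-complete p) (there (here refl))

part? : ∀ A s B → Dec (Part A s B)
part? A s B = map′ (parts-sound whole) parts-complete ((s , B) ∈? parts + A)
  where open import Data.List.Membership.DecPropositional (≡-dec Sign._≟_ _≟_) using (_∈?_)

clash? : ∀ A → Dec (Clash A)
clash? A = map′ to from (any? both? (parts + A))
  where
  -- Non-overlap is left out of the search; `clash` restores it.
  Both : Sign × Formula → Set
  Both (s , B) = s ≡ + × Part A - B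

  both? : ∀ x → Dec (Both x)
  both? (s , B) = s Sign.≟ + ×-dec part? A - B

  to : Any Both (parts + A) → Clash A
  to m with find m
  ... | _ , n , refl , q = clash (parts-sound whole n) q

  from : Clash A → Any Both (parts + A)
  from (_ , p , q , _) = lose (parts-complete p) (refl , q)

irreducible⇒hintikka : ∀ {A} → ¬ Clash A → ¬ Reducible A → Hintikka A
irreducible⇒hintikka {A} ¬clash irreducible = record
  { noClash = ¬clash
  ; disj    = disj
  ; refl-ε  = λ p → forced λ _ → ε₁ p
  -- If the two atoms coincide, their names are all equal and the atom to be appended is already the
  -- negative part `p`; otherwise they cannot overlap. The same holds for `sym-ε`.
  ; trans-ε = λ p q → forced λ ¬ac →
      ε₂ p q (atoms-nonOverlapping λ { refl → ¬ac p })
  ; sym-ε   = λ p q → forced λ ¬ba →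
      ε₃b p q (atoms-nonOverlapping λ { refl → ¬ba p })
  }
  where
  -- The absence of `X` is passed to `rule` because the non-overlap conditions rest on it.
  forced : ∀ {X} → (¬ Part A - X → A ⟶ X) → Part A - X
  forced {X} rule = decidable-stable (part? A - X) λ ¬X →
    irreducible (inj₁ (X , rule ¬X , ¬clash , ¬X))

  disj : ∀ {B C} → Part A - (B ∨ C) → Part A - B ⊎ Part A - C
  disj {B} {C} p with part? A - B | part? A - C
  ... | yes b | _     = inj₁ b
  ... | no _  | yes c = inj₂ c
  ... | no ¬b | no ¬c =
    contradiction (inj₂ (B , C , ∨₋ p , ¬clash , ¬b , ¬c)) irreducible

module _ {H : Formula} (hintikka : Hintikka H) where
  open Hintikka hintikka

  -- ¬ Part H - B rather than Part H + B: the formulas along a tableau are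
  -- positive parts of themselves but need not be parts of H.
  Agrees : Sign → Formula → Set
  Agrees + B = ¬ Part H - B
  Agrees - B = Part H - B

  Compatible : Formula → Set
  Compatible A = ∀ {s B} → Part A s B → Agrees s B

  part⇒agrees : ∀ {s B} → Part H s B → Agrees s B
  part⇒agrees {+} p q = noClash (clash p q)
  part⇒agrees { - } p = p

  -- Once `X` is a negative part of `H`, everything strictly inside `~ X` is a part of `H` with the
  -- same sign, so only `all` and `appended` need a new argument.
  data ExtensionPart (A X : Formula) : Sign → Formula → Set where
    all      : ExtensionPart A X + (A ∨ ~ X)
    appended : ExtensionPart A X + (~ X)
    old      : ∀ {s B} → Part A s B → ExtensionPart A X s B
    inH      : ∀ {s B} → Part H s B → ExtensionPart A X s B

  extensionPart : ∀ {A X s B} → Part H - X → Part (A ∨ ~ X) s B → ExtensionPart A X s B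
  extensionPart x whole = all
  extensionPart x (left p) with extensionPart x p
  ... | all   = old whole
  ... | old q = old (left q)
  ... | inH q = inH (left q)
  extensionPart x (right p) with extensionPart x p
  ... | all   = appended
  ... | old q = old (right q)
  ... | inH q = inH (right q)
  extensionPart x (neg⁺ p) with extensionPart x p
  ... | appended = inH x
  ... | old q    = old (neg⁺ q)
  ... | inH q    = inH (neg⁺ q)
  extensionPart x (neg⁻ p) with extensionPart x p
  ... | old q = old (neg⁻ q)
  ... | inH q = inH (neg⁻ q)

  extend : ∀ {A X} → Compatible A → Part H - X → Compatible (A ∨ ~ X)
  extend {A} {X} compatible x p = agrees (extensionPart x p)
    where
    agrees : ∀ {s B} → ExtensionPart A X s B → Agrees s B
    -- Were the new disjunction a negative part of `H`, so would be `A`, against `compatible`, or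
    -- `~ X`, which makes `X` a positive part too.
    agrees all q with disj q
    ... | inj₁ a  = compatible whole a
    ... | inj₂ ~x = noClash (clash (neg⁻ ~x) x)
    agrees appended ~x = noClash (clash (neg⁻ ~x) x)
    agrees (old q)     = compatible q
    agrees (inH q)     = part⇒agrees q

  preserves : ∀ {A X} → Compatible A → A ⟶ X → Part H - X
  preserves compatible (ε₁ p)      = refl-ε (compatible p)
  preserves compatible (ε₂ p q _)  = trans-ε (compatible p) (compatible q)
  preserves compatible (ε₃b p q _) = sym-ε (compatible p) (compatible q)

  compatible⇒¬closed : ∀ {A} → Compatible A → (T : Tableau A) → ¬ Closed T
  compatible⇒¬closed compatible leaf closed with closed end
  ... | _ , p , q , _ = compatible p (compatible q)
  compatible⇒¬closed compatible (one r T) closed =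
    compatible⇒¬closed (extend compatible (preserves compatible r)) T (closed ∘ one)
  compatible⇒¬closed compatible (two (∨₋ p) T U) closed with disj (compatible p)
  ... | inj₁ b = compatible⇒¬closed (extend compatible b) T (closed ∘ two₁)
  ... | inj₂ c = compatible⇒¬closed (extend compatible c) U (closed ∘ two₂)

theorem6p6 : (A : Formula) → (Σ[ T ∈ Tableau A ] (Normal T × Closed T)) →
    ((T : Tableau A) → Normal T → ¬ (Σ[ β ∈ Branch T ] Hintikka (lastFormula β)))
    × ((T : Tableau A) → Completed T → Closed T)
theorem6p6 A (T₀ , _ , closed) = (λ T _ → noHintikka T) , completed⇒closed
  where
  noHintikka : (T : Tableau A) → ¬ (Σ[ β ∈ Branch T ] Hintikka (lastFormula β))
  noHintikka T (β , hintikka) = compatible⇒¬closed hintikka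
    -- Parts of `A` are parts of the Hintikka formula with the same sign, so the root is compatible.
    (part⇒agrees hintikka ∘ part-trans (root-part β)) T₀ closed

  completed⇒closed : (T : Tableau A) → Completed T → Closed T
  completed⇒closed T (_ , irreducible) β = decidable-stable (clash? (lastFormula β)) λ ¬clash →
    noHintikka T (β , irreducible⇒hintikka ¬clash (irreducible β))
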